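{- Let $I$ be a semimatched ideal and $W$ a set of words in $\{1,\dots,N\}$ all of the same length. Then $\sum_{\mathsf w\in W}\mathsf w\in I^\perp$ if and only if $W$ is the vertex set of an $I$-switchboard.
   Context: $\mathcal U=\mathbb Z\langle u_1,\dots,u_N\rangle$, $\mathbf u_{\mathsf w}=u_{\mathsf w_1}\cdots u_{\mathsf w_n}$; $\mathcal U^*$ is the free $\mathbb Z$-module on words with $\langle\mathbf u_{\mathsf w},\mathsf v\rangle=\delta_{\mathsf v\mathsf w}$ and $I^\perp=\{\gamma:\langle z,\gamma\rangle=0\ \forall z\in I\}$. $I_{\mathrm S}$ is the two-sided ideal generated by $u_b^2u_a+u_au_bu_a-u_bu_au_b-u_bu_a^2$ ($b-a=1$); $u_b^2u_a-u_bu_au_b$ and $u_bu_a^2-u_au_bu_a$ ($b-a\ge2$); $u_bu_cu_a+u_au_cu_b-u_bu_au_c-u_cu_au_b$ ($a<b<c$). Semimatched ideal: declare each 3-element subset $\{a<b<c\}\subseteq\{1,\dots,N\}$ to be a Knuth, rotation, or undecided triple, and each pair $\{a,a+1\}$ a Knuth, braid/idempotent, or undecided pair; let $I_M$ be a monomial ideal (generated by monomials). The associated semimatched ideal $I$ is generated by $I_M$, $I_{\mathrm S}$, and: $u_au_cu_b-u_cu_au_b$ and $u_bu_au_c-u_bu_cu_a$ for Knuth triples; $u_au_cu_b-u_bu_au_c$ and $u_cu_au_b-u_bu_cu_a$ for rotation triples; $u_au_bu_a-u_bu_au_a$ and $u_bu_au_b-u_bu_bu_a$ for Knuth pairs $\{a,b=a+1\}$;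 $u_au_bu_a-u_bu_au_b$ and $u_bu_au_a-u_bu_bu_a$ for braid/idempotent pairs $\{a,b=a+1\}$. A switchboard is an edge-labeled graph whose vertex set is a set of words of a fixed length $n$, edge labels in $\{2,\dots,n-1\}$, each $i$-edge $\{\mathsf w,\mathsf w'\}$ having $\mathsf w_j=\mathsf w'_j$ for $j\notin\{i-1,i,i+1\}$ and $\{\mathsf w_{i-1}\mathsf w_i\mathsf w_{i+1},\mathsf w'_{i-1}\mathsf w'_i\mathsf w'_{i+1}\}$ one of $\{bac,bca\},\{acb,cab\},\{bac,acb\},\{bca,cab\}$ ($a<b<c$), $\{bab,bba\},\{aba,baa\}$ ($a<b$), $\{bab,aba\},\{bba,baa\}$ ($b=a+1$), such that each vertex for which exactly one of positions $i-1,i$ is a descent ($\mathsf w_p>\mathsf w_{p+1}$) lies on exactly one $i$-edge. An $I$-switchboard is a switchboard in which every vertex $\mathsf w$ has $\mathbf u_{\mathsf w}\notin I_M$ and every edge's triple-pair fits one of: $\{bac,bca\}$ or $\{acb,cab\}$ for Knuth or undecided triples $a<b<c$; $\{bac,acb\}$ or $\{bca,cab\}$ for rotation or undecided triples; $\{aba,baa\}$ or $\{bab,bba\}$ for $b-a>1$; $\{aba,baa\}$ or $\{bab,bba\}$ for Knuth or undecided pairs with $b=a+1$; $\{aba,bab\}$ or $\{baa,bba\}$ for braid/idempotent or undecided pairs with $b=a+1$. -}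

module Defs where

open import Data.Nat as ℕ using (ℕ; zero; suc; _∸_)
open import Data.Integer as ℤ using (ℤ; +_; -[1+_])
open import Data.Fin as Fin using (Fin; toℕ)
open import Data.List using (List; []; _∷_; _++_; length; map; concatMap; foldr)
open import Data.List.Properties using (≡-dec)
open import Data.List.Membership.Propositional using (_∈_)
open import Data.List.Relation.Unary.Unique.Propositional using (Unique)
open import Data.List.Relation.Unary.All using (All)
open import Data.Maybe using (Maybe; just; nothing)
open import Data.Product using (Σ; ∃; _×_; _,_; Σ-syntax; ∃-syntax)
open import Data.Sum using (_⊎_)
open import Relation.Nullary using (¬_; Dec; yes; no)
open import Relation.Binary.PropositionalEquality using (_≡_)

-- Letters are Fin N (Fin.zero plays the role of letter 1, etc.),
-- ordered by toℕ.  Words are lists of letters.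

Word : ℕ → Set
Word N = List (Fin N)

_≟W_ : ∀ {N} (v w : Word N) → Dec (v ≡ w)
_≟W_ = ≡-dec Fin._≟_

-- The free associative ring U = ℤ⟨u_1,…,u_N⟩.
-- An element is represented by a finite formal sum of terms c·u_w;
-- two representations denote the same element iff all coefficients agree.

Poly : ℕ → Set
Poly N = List (ℤ × Word N)

δ : ∀ {N} → Word N → Word N → ℤ
δ v w with v ≟W w
... | yes _ = + 1
... | no  _ = + 0

coeff : ∀ {N} → Poly N → Word N → ℤ
coeff [] w = + 0
coeff ((c , v) ∷ p) w = c ℤ.* δ v w ℤ.+ coeff p w

_≈P_ : ∀ {N} → Poly N → Poly N → Set
p ≈P q = ∀ w → coeff p w ≡ coeff q w

_*P_ : ∀ {N} → Poly N → Poly N → Poly N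
p *P q = concatMap (λ { (c , v) → map (λ { (d , w) → (c ℤ.* d , v ++ w) }) q }) p

u : ∀ {N} → Word N → Poly N
u w = (+ 1 , w) ∷ []

data InIdeal {N : ℕ} (G : Poly N → Set) : Poly N → Set where
  gen  : ∀ {g} → G g → InIdeal G g
  zero : InIdeal G []
  add  : ∀ {p q} → InIdeal G p → InIdeal G q → InIdeal G (p ++ q)
  lmul : ∀ {p} (r : Poly N) → InIdeal G p → InIdeal G (r *P p)
  rmul : ∀ {p} (r : Poly N) → InIdeal G p → InIdeal G (p *P r)
  resp : ∀ {p q} → InIdeal G p → p ≈P q → InIdeal G q

-- The dual U* : an element γ is given by its coefficients γ(w) on words;
-- ⟨u_w , v⟩ = δ_{vw}, extended bilinearly.

Dual : ℕ → Set
Dual N = Word N → ℤ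

⟨_,_⟩ : ∀ {N} → Poly N → Dual N → ℤ
⟨ [] , γ ⟩ = + 0
⟨ (c , w) ∷ p , γ ⟩ = c ℤ.* γ w ℤ.+ ⟨ p , γ ⟩

InPerp : ∀ {N} → (Poly N → Set) → Dual N → Set
InPerp G γ = ∀ z → InIdeal G z → ⟨ z , γ ⟩ ≡ + 0

-- Σ_{w ∈ W} w  for a finite set W of words (given as a duplicate-free list)
sumOf : ∀ {N} → List (Word N) → Dual N
sumOf W w = foldr (λ v acc → δ v w ℤ.+ acc) (+ 0) W

data TripleType : Set where
  knuthT rotationT undecidedT : TripleType

data PairType : Set where
  knuthP braidP undecidedP : PairType

record SemimatchedData (N : ℕ) : Set₁ where
  field
    -- type of the triple {a<b<c}; only consulted at a < b < c
    triple : Fin N → Fin N → Fin N → TripleType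
    -- type of the pair {a, a+1}; consulted at a (with a+1 a letter)
    pair   : Fin N → PairType
    monoGen : Word N → Set
open SemimatchedData public

_<F_ : ∀ {N} → Fin N → Fin N → Set
a <F b = toℕ a ℕ.< toℕ b

Succ : ∀ {N} → Fin N → Fin N → Set
Succ a b = toℕ b ≡ suc (toℕ a)

m3 : ∀ {N} → ℤ → Fin N → Fin N → Fin N → ℤ × Word N
m3 c x y z = (c , x ∷ y ∷ z ∷ [])

p1 m1 : ℤ
p1 = + 1
m1 = -[1+ 0 ]

data MonoGen {N} (D : SemimatchedData N) : Poly N → Set where
  mono : ∀ {w} → monoGen D w → MonoGen D (u w)

data SGen {N} (D : SemimatchedData N) : Poly N → Set where
  mono : ∀ {w} → monoGen D w → SGen D (u w)
  s-adj : ∀ {a b} → Succ a b →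
    SGen D (m3 p1 b b a ∷ m3 p1 a b a ∷ m3 m1 b a b ∷ m3 m1 b a a ∷ [])
  s-far1 : ∀ {a b} → suc (toℕ a) ℕ.< toℕ b →
    SGen D (m3 p1 b b a ∷ m3 m1 b a b ∷ [])
  s-far2 : ∀ {a b} → suc (toℕ a) ℕ.< toℕ b →
    SGen D (m3 p1 b a a ∷ m3 m1 a b a ∷ [])
  s-tri : ∀ {a b c} → a <F b → b <F c →
    SGen D (m3 p1 b c a ∷ m3 p1 a c b ∷ m3 m1 b a c ∷ m3 m1 c a b ∷ [])
  kt1 : ∀ {a b c} → a <F b → b <F c → triple D a b c ≡ knuthT →
    SGen D (m3 p1 a c b ∷ m3 m1 c a b ∷ [])
  kt2 : ∀ {a b c} → a <F b → b <F c → triple D a b c ≡ knuthT →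
    SGen D (m3 p1 b a c ∷ m3 m1 b c a ∷ [])
  rt1 : ∀ {a b c} → a <F b → b <F c → triple D a b c ≡ rotationT →
    SGen D (m3 p1 a c b ∷ m3 m1 b a c ∷ [])
  rt2 : ∀ {a b c} → a <F b → b <F c → triple D a b c ≡ rotationT →
    SGen D (m3 p1 c a b ∷ m3 m1 b c a ∷ [])
  kp1 : ∀ {a b} → Succ a b → pair D a ≡ knuthP →
    SGen D (m3 p1 a b a ∷ m3 m1 b a a ∷ [])
  kp2 : ∀ {a b} → Succ a b → pair D a ≡ knuthP →
    SGen D (m3 p1 b a b ∷ m3 m1 b b a ∷ [])
  bp1 : ∀ {a b} → Succ a b → pair D a ≡ braidP →
    SGen D (m3 p1 a b a ∷ m3 m1 b a b ∷ [])
  bp2 : ∀ {a b} → Succ a b → pair D a ≡ braidP →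
    SGen D (m3 p1 b a a ∷ m3 m1 b b a ∷ [])

Triple : ℕ → Set
Triple N = Fin N × Fin N × Fin N

tr : ∀ {N} → Fin N → Fin N → Fin N → Triple N
tr x y z = x , y , z

-- the allowed (ordered) local moves; an edge uses one of these in
-- either direction
data Form {N} : Triple N → Triple N → Set where
  f-bac-bca : ∀ {a b c} → a <F b → b <F c → Form (tr b a c) (tr b c a)
  f-acb-cab : ∀ {a b c} → a <F b → b <F c → Form (tr a c b) (tr c a b)
  f-bac-acb : ∀ {a b c} → a <F b → b <F c → Form (tr b a c) (tr a c b)
  f-bca-cab : ∀ {a b c} → a <F b → b <F c → Form (tr b c a) (tr c a b)
  f-bab-bba : ∀ {a b} → a <F b → Form (tr b a b) (tr b b a)
  f-aba-baa : ∀ {a b} → a <F b → Form (tr a b a) (tr b a a)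
  f-bab-aba : ∀ {a b} → Succ a b → Form (tr b a b) (tr a b a)
  f-bba-baa : ∀ {a b} → Succ a b → Form (tr b b a) (tr b a a)

data Fits {N} (D : SemimatchedData N) : Triple N → Triple N → Set where
  t-bac-bca : ∀ {a b c} → a <F b → b <F c →
    (triple D a b c ≡ knuthT ⊎ triple D a b c ≡ undecidedT) → Fits D (tr b a c) (tr b c a)
  t-acb-cab : ∀ {a b c} → a <F b → b <F c →
    (triple D a b c ≡ knuthT ⊎ triple D a b c ≡ undecidedT) → Fits D (tr a c b) (tr c a b)
  t-bac-acb : ∀ {a b c} → a <F b → b <F c →
    (triple D a b c ≡ rotationT ⊎ triple D a b c ≡ undecidedT) → Fits D (tr b a c) (tr a c b)
  t-bca-cab : ∀ {a b c} → a <F b → b <F c →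
    (triple D a b c ≡ rotationT ⊎ triple D a b c ≡ undecidedT) → Fits D (tr b c a) (tr c a b)
  far-aba-baa : ∀ {a b} → suc (toℕ a) ℕ.< toℕ b → Fits D (tr a b a) (tr b a a)
  far-bab-bba : ∀ {a b} → suc (toℕ a) ℕ.< toℕ b → Fits D (tr b a b) (tr b b a)
  kp-aba-baa : ∀ {a b} → Succ a b →
    (pair D a ≡ knuthP ⊎ pair D a ≡ undecidedP) → Fits D (tr a b a) (tr b a a)
  kp-bab-bba : ∀ {a b} → Succ a b →
    (pair D a ≡ knuthP ⊎ pair D a ≡ undecidedP) → Fits D (tr b a b) (tr b b a)
  bp-aba-bab : ∀ {a b} → Succ a b →
    (pair D a ≡ braidP ⊎ pair D a ≡ undecidedP) → Fits D (tr a b a) (tr b a b)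
  bp-baa-bba : ∀ {a b} → Succ a b →
    (pair D a ≡ braidP ⊎ pair D a ≡ undecidedP) → Fits D (tr b a a) (tr b b a)

-- w and w' differ only in positions i-1, i, i+1 (1-indexed), where they
-- read t and t' respectively
LocalAt : ∀ {N} → ℕ → Word N → Word N → Triple N → Triple N → Set
LocalAt {N} i w w' (x , y , z) (x' , y' , z') =
  Σ[ pre ∈ Word N ] Σ[ suf ∈ Word N ]
    length pre ≡ i ∸ 2 ×
    w  ≡ pre ++ x  ∷ y  ∷ z  ∷ suf ×
    w' ≡ pre ++ x' ∷ y' ∷ z' ∷ suf

-- 0-indexed lookup
_!_ : ∀ {A : Set} → List A → ℕ → Maybe A
[] ! _ = nothing
(x ∷ xs) ! zero = just x
(x ∷ xs) ! suc k = xs ! k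

-- position p (1-indexed) is a descent of w : w_p > w_{p+1}
Descent : ∀ {N} → Word N → ℕ → Set
Descent w p = ∃[ x ] ∃[ y ] (w ! (p ∸ 1) ≡ just x × w ! p ≡ just y × y <F x)

ExactlyOneDescent : ∀ {N} → Word N → ℕ → Set
ExactlyOneDescent w i =
  (Descent w (i ∸ 1) × ¬ Descent w i) ⊎ (¬ Descent w (i ∸ 1) × Descent w i)

-- Edge relation: E i w w' means {w, w'} is an i-edge.
record IsSwitchboard {N} (n : ℕ) (W : List (Word N))
                     (E : ℕ → Word N → Word N → Set) : Set where
  field
    sym    : ∀ {i w w'} → E i w w' → E i w' w
    ends   : ∀ {i w w'} → E i w w' → w ∈ W × w' ∈ W
    label  : ∀ {i w w'} → E i w w' → 2 ℕ.≤ i × i ℕ.≤ n ∸ 1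
    shape  : ∀ {i w w'} → E i w w' →
               Σ[ t ∈ Triple N ] Σ[ t' ∈ Triple N ]
                 LocalAt i w w' t t' × (Form t t' ⊎ Form t' t)
    unique : ∀ {i w} → w ∈ W → 2 ℕ.≤ i → i ℕ.≤ n ∸ 1 → ExactlyOneDescent w i →
               Σ[ w' ∈ Word N ] (E i w w' × (∀ w'' → E i w w'' → w'' ≡ w'))

record IsISwitchboard {N} (D : SemimatchedData N) (n : ℕ) (W : List (Word N))
                      (E : ℕ → Word N → Word N → Set) : Set where
  field
    switchboard : IsSwitchboard n W E
    notInIM     : ∀ {w} → w ∈ W → ¬ InIdeal (MonoGen D) (u w)
    fits        : ∀ {i w w'} → E i w w' →
                    Σ[ t ∈ Triple N ] Σ[ t' ∈ Triple N ]
                      LocalAt i w w' t t' × (Fits D t t' ⊎ Fits D t' t)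

module Submission where

-- Pairing with Σ_{w ∈ W} w kills I exactly when it kills every generator g placed in every context
-- x·g·y.  A generator lives on a three-letter factor, so this only concerns which of the four
-- arrangements x·t·y of a cell (a triple a < b < c or a pair a < b) lie in W: W must avoid I_M, the
-- occupied arrangements must be closed under the Knuth (resp. rotation) matching on cells of Knuth
-- (resp. rotation) type, and as many X- as Y-arrangements must be occupied.  An I-switchboard yields
-- exactly these local relations, since an arrangement with one descent has a unique edge and the
-- fitting condition sends it to its partner under an allowed matching.  Conversely the relations let
-- one choose at each cell an allowed matching that preserves W, and its pairs are the edges of an
-- I-switchboard.

open import Defs
open import Data.Bool as Bool using (Bool; true; false)
open import Data.Empty using (⊥; ⊥-elim)
open import Data.Fin using (Fin; toℕ)
import Data.Fin.Properties as Finₚ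
open import Data.Integer as ℤ using (ℤ; +_)
import Data.Integer.Properties as ℤₚ
open import Data.Integer.Solver using (module +-*-Solver)
open import Data.List using (List; []; _∷_; _++_; length; map)
import Data.List.Properties as Listₚ
open import Data.List.Membership.Propositional using (_∈_; _∉_)
open import Data.List.Relation.Unary.All as All using (All; _∷_)
open import Data.List.Relation.Unary.Any using (here; there)
open import Data.List.Relation.Unary.AllPairs using (_∷_)
open import Data.List.Relation.Unary.Unique.Propositional using (Unique)
open import Data.Maybe using (Maybe; just; nothing)
open import Data.Maybe.Properties using (just-injective)
open import Data.Nat as ℕ using (ℕ; zero; suc)
import Data.Nat.Properties as ℕₚ
open import Data.Product using (Σ; _×_; _,_; proj₁; proj₂)
open import Data.Sum using (_⊎_; inj₁; inj₂; swap)
open import Function using (const; _∘_; case_of_)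
open import Relation.Nullary using (¬_; yes; no)
open import Relation.Nullary.Decidable using (isYes)
open import Relation.Binary using (tri<; tri≈; tri>)
open import Relation.Binary.PropositionalEquality hiding (resp)

open +-*-Solver

module _ {N : ℕ} where

  ⟨⟩-++ : ∀ (p q : Poly N) γ → ⟨ p ++ q , γ ⟩ ≡ ⟨ p , γ ⟩ ℤ.+ ⟨ q , γ ⟩
  ⟨⟩-++ [] q γ = sym (ℤₚ.+-identityˡ _)
  ⟨⟩-++ ((c , w) ∷ p) q γ rewrite ⟨⟩-++ p q γ = sym (ℤₚ.+-assoc (c ℤ.* γ w) _ _)

  ⟨⟩-cong : ∀ (p : Poly N) {γ γ′} → γ ≗ γ′ → ⟨ p , γ ⟩ ≡ ⟨ p , γ′ ⟩
  ⟨⟩-cong [] e = refl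
  ⟨⟩-cong ((c , w) ∷ p) e = cong₂ (λ a b → c ℤ.* a ℤ.+ b) (e w) (⟨⟩-cong p e)

  ⟨⟩-zeroʳ : ∀ (p : Poly N) {γ} → γ ≗ const (+ 0) → ⟨ p , γ ⟩ ≡ + 0
  ⟨⟩-zeroʳ [] z = refl
  ⟨⟩-zeroʳ ((c , w) ∷ p) z rewrite z w | ⟨⟩-zeroʳ p z | ℤₚ.*-zeroʳ c = refl

  ⟨⟩-linearʳ : ∀ (p : Poly N) c γ γ′ →
    ⟨ p , (λ w → c ℤ.* γ w ℤ.+ γ′ w) ⟩ ≡ c ℤ.* ⟨ p , γ ⟩ ℤ.+ ⟨ p , γ′ ⟩
  ⟨⟩-linearʳ [] c γ γ′ = sym (trans (ℤₚ.+-identityʳ _) (ℤₚ.*-zeroʳ c))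
  ⟨⟩-linearʳ ((d , w) ∷ p) c γ γ′ rewrite ⟨⟩-linearʳ p c γ γ′ =
    solve 6 (λ d c f g a b → d :* (c :* f :+ g) :+ (c :* a :+ b) := c :* (d :* f :+ a) :+ (d :* g :+ b))
      refl d c (γ w) (γ′ w) ⟨ p , γ ⟩ ⟨ p , γ′ ⟩

  ⟨⟩-swap : ∀ (p q : Poly N) (f : Word N → Word N → ℤ) →
    ⟨ p , (λ v → ⟨ q , f v ⟩) ⟩ ≡ ⟨ q , (λ w → ⟨ p , (λ v → f v w) ⟩) ⟩
  ⟨⟩-swap [] q f = sym (⟨⟩-zeroʳ q (λ _ → refl))
  ⟨⟩-swap ((c , v) ∷ p) q f rewrite ⟨⟩-swap p q f =
    sym (⟨⟩-linearʳ q c (f v) (λ w → ⟨ p , (λ v → f v w) ⟩))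

  -- The scaling map is taken as a parameter because the pattern lambda inside _*P_ cannot be restated.
  ⟨⟩-scale : ∀ (q : Poly N) γ c v (f : ℤ × Word N → ℤ × Word N) →
    (∀ d w → f (d , w) ≡ (c ℤ.* d , v ++ w)) →
    ⟨ map f q , γ ⟩ ≡ c ℤ.* ⟨ q , (λ w → γ (v ++ w)) ⟩
  ⟨⟩-scale [] γ c v f e = sym (ℤₚ.*-zeroʳ c)
  ⟨⟩-scale ((d , w) ∷ q) γ c v f e rewrite e d w | ⟨⟩-scale q γ c v f e =
    solve 4 (λ c d g r → (c :* d) :* g :+ c :* r := c :* (d :* g :+ r))
      refl c d (γ (v ++ w)) ⟨ q , (λ w → γ (v ++ w)) ⟩

  ⟨⟩-*P : ∀ (p q : Poly N) γ → ⟨ p *P q , γ ⟩ ≡ ⟨ p , (λ v → ⟨ q , (λ w → γ (v ++ w)) ⟩) ⟩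
  ⟨⟩-*P [] q γ = refl
  ⟨⟩-*P ((c , v) ∷ p) q γ =
    trans (⟨⟩-++ (map _ q) (p *P q) γ)
          (cong₂ ℤ._+_ (⟨⟩-scale q γ c v _ (λ d w → refl)) (⟨⟩-*P p q γ))

  δ-refl : (v : Word N) → δ v v ≡ + 1
  δ-refl v with v ≟W v
  ... | yes _ = refl
  ... | no v≢v = ⊥-elim (v≢v refl)

  δ-≢ : {v w : Word N} → v ≢ w → δ v w ≡ + 0
  δ-≢ {v} {w} v≢w with v ≟W w
  ... | yes v≡w = ⊥-elim (v≢w v≡w)
  ... | no _ = refl

  *0+ : ∀ c k → c ℤ.* + 0 ℤ.+ k ≡ k
  *0+ c k rewrite ℤₚ.*-zeroʳ c = ℤₚ.+-identityˡ k

  dropWord : Word N → Poly N → Poly N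
  dropWord v [] = []
  dropWord v ((c , w) ∷ r) with w ≟W v
  ... | yes _ = dropWord v r
  ... | no _ = (c , w) ∷ dropWord v r

  length-dropWord : ∀ v (r : Poly N) → length (dropWord v r) ℕ.≤ length r
  length-dropWord v [] = ℕ.z≤n
  length-dropWord v ((c , w) ∷ r) with w ≟W v
  ... | yes _ = ℕₚ.m≤n⇒m≤1+n (length-dropWord v r)
  ... | no _ = ℕ.s≤s (length-dropWord v r)

  coeff-dropWord-same : ∀ v (r : Poly N) → coeff (dropWord v r) v ≡ + 0
  coeff-dropWord-same v [] = refl
  coeff-dropWord-same v ((c , w) ∷ r) with w ≟W v
  ... | yes _ = coeff-dropWord-same v r
  ... | no w≢v rewrite δ-≢ w≢v = trans (*0+ c _) (coeff-dropWord-same v r)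

  coeff-dropWord-other : ∀ {v w} (r : Poly N) → w ≢ v → coeff (dropWord v r) w ≡ coeff r w
  coeff-dropWord-other [] _ = refl
  coeff-dropWord-other {v} {w} ((c , x) ∷ r) w≢v with x ≟W v
  ... | yes refl rewrite δ-≢ (w≢v ∘ sym) = trans (coeff-dropWord-other r w≢v) (sym (*0+ c _))
  ... | no _ = cong (λ k → c ℤ.* δ x w ℤ.+ k) (coeff-dropWord-other r w≢v)

  ⟨⟩-split : ∀ (r : Poly N) v γ → ⟨ r , γ ⟩ ≡ coeff r v ℤ.* γ v ℤ.+ ⟨ dropWord v r , γ ⟩
  ⟨⟩-split [] v γ = refl
  ⟨⟩-split ((c , w) ∷ r) v γ with w ≟W v
  ... | yes refl rewrite ⟨⟩-split r w γ =
    solve 4 (λ c g k x → c :* g :+ (k :* g :+ x) := (c :* con (+ 1) :+ k) :* g :+ x)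
      refl c (γ w) (coeff r w) ⟨ dropWord w r , γ ⟩
  ... | no _ rewrite ⟨⟩-split r v γ | *0+ c (coeff r v) =
    solve 4 (λ c g k x → c :* g :+ (k :+ x) := k :+ (c :* g :+ x))
      refl c (γ w) (coeff r v ℤ.* γ v) ⟨ dropWord v r , γ ⟩

  -- Induction on a length bound k, since dropWord may remove several terms at once.
  ⟨⟩-coeff-zero : ∀ k (r : Poly N) γ → length r ℕ.≤ k → (∀ w → coeff r w ≡ + 0) → ⟨ r , γ ⟩ ≡ + 0
  ⟨⟩-coeff-zero k [] γ _ _ = refl
  ⟨⟩-coeff-zero (suc k) r@((c , v) ∷ r′) γ (ℕ.s≤s len≤k) coeff≡0 = begin
    ⟨ r , γ ⟩                                      ≡⟨ ⟨⟩-split r v γ ⟩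
    coeff r v ℤ.* γ v ℤ.+ ⟨ dropWord v r , γ ⟩
      ≡⟨ cong₂ (λ a b → a ℤ.* γ v ℤ.+ b) (coeff≡0 v)
               (⟨⟩-coeff-zero k (dropWord v r) γ length-rest coeff-rest≡0) ⟩
    + 0                                            ∎
    where
    open ≡-Reasoning
    length-rest : length (dropWord v r) ℕ.≤ k
    length-rest with v ≟W v
    ... | yes _ = ℕₚ.≤-trans (length-dropWord v r′) len≤k
    ... | no v≢v = ⊥-elim (v≢v refl)
    coeff-rest≡0 : ∀ w → coeff (dropWord v r) w ≡ + 0
    coeff-rest≡0 w with w ≟W v
    ... | yes refl = coeff-dropWord-same v r
    ... | no w≢v = trans (coeff-dropWord-other r w≢v) (coeff≡0 w)

  negP : Poly N → Poly N
  negP = map (λ { (c , w) → (ℤ.- c , w) })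

  coeff-++ : ∀ (p q : Poly N) w → coeff (p ++ q) w ≡ coeff p w ℤ.+ coeff q w
  coeff-++ [] q w = sym (ℤₚ.+-identityˡ _)
  coeff-++ ((c , v) ∷ p) q w rewrite coeff-++ p q w = sym (ℤₚ.+-assoc (c ℤ.* δ v w) _ _)

  coeff-negP : ∀ (q : Poly N) w → coeff (negP q) w ≡ ℤ.- coeff q w
  coeff-negP [] w = refl
  coeff-negP ((c , v) ∷ q) w rewrite coeff-negP q w =
    solve 3 (λ c d k → (:- c) :* d :+ (:- k) := :- (c :* d :+ k)) refl c (δ v w) (coeff q w)

  ⟨⟩-negP : ∀ (q : Poly N) γ → ⟨ negP q , γ ⟩ ≡ ℤ.- ⟨ q , γ ⟩
  ⟨⟩-negP [] γ = refl
  ⟨⟩-negP ((c , v) ∷ q) γ rewrite ⟨⟩-negP q γ =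
    solve 3 (λ c d k → (:- c) :* d :+ (:- k) := :- (c :* d :+ k)) refl c (γ v) ⟨ q , γ ⟩

  ⟨⟩-resp-≈P : ∀ {p q : Poly N} γ → p ≈P q → ⟨ p , γ ⟩ ≡ ⟨ q , γ ⟩
  ⟨⟩-resp-≈P {p} {q} γ p≈q = ℤₚ.i-j≡0⇒i≡j _ _ (begin
    ⟨ p , γ ⟩ ℤ.- ⟨ q , γ ⟩                  ≡⟨ cong (λ k → ⟨ p , γ ⟩ ℤ.+ k) (⟨⟩-negP q γ) ⟨
    ⟨ p , γ ⟩ ℤ.+ ⟨ negP q , γ ⟩             ≡⟨ ⟨⟩-++ p (negP q) γ ⟨
    ⟨ p ++ negP q , γ ⟩                      ≡⟨ ⟨⟩-coeff-zero _ (p ++ negP q) γ ℕₚ.≤-refl coeff≡0 ⟩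
    + 0                                      ∎)
    where
    open ≡-Reasoning
    coeff≡0 : ∀ w → coeff (p ++ negP q) w ≡ + 0
    coeff≡0 w rewrite coeff-++ p (negP q) w | coeff-negP q w | p≈q w = ℤₚ.+-inverseʳ (coeff q w)

  shift : Word N → Word N → Dual N → Dual N
  shift x y γ t = γ (x ++ t ++ y)

  ⟨⟩-context : ∀ x y g γ → ⟨ (u x *P g) *P u y , γ ⟩ ≡ ⟨ g , shift x y γ ⟩
  ⟨⟩-context x y g γ = begin
    ⟨ (u x *P g) *P u y , γ ⟩                                   ≡⟨ ⟨⟩-*P (u x *P g) (u y) γ ⟩
    ⟨ u x *P g , (λ v → + 1 ℤ.* γ (v ++ y) ℤ.+ + 0) ⟩           ≡⟨ ⟨⟩-*P (u x) g _ ⟩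
    + 1 ℤ.* ⟨ g , (λ w → + 1 ℤ.* γ ((x ++ w) ++ y) ℤ.+ + 0) ⟩ ℤ.+ + 0
      ≡⟨ trans (ℤₚ.+-identityʳ _) (ℤₚ.*-identityˡ _) ⟩
    ⟨ g , (λ w → + 1 ℤ.* γ ((x ++ w) ++ y) ℤ.+ + 0) ⟩           ≡⟨ ⟨⟩-cong g reassociate ⟩
    ⟨ g , shift x y γ ⟩                                         ∎
    where
    open ≡-Reasoning
    reassociate : ∀ w → + 1 ℤ.* γ ((x ++ w) ++ y) ℤ.+ + 0 ≡ γ (x ++ w ++ y)
    reassociate w = trans (ℤₚ.+-identityʳ _)
                   (trans (ℤₚ.*-identityˡ _) (cong γ (Listₚ.++-assoc x w y)))

  AnnihilatesShifts : (Poly N → Set) → Dual N → Set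
  AnnihilatesShifts G γ = ∀ {g} → G g → ∀ x y → ⟨ g , shift x y γ ⟩ ≡ + 0

  -- Shifting by x and y is what lets the claim absorb left and right multiplication.
  AnnihilatesShifts⇒ideal : ∀ {G} γ → AnnihilatesShifts G γ →
    ∀ {z} → InIdeal G z → ∀ x y → ⟨ z , shift x y γ ⟩ ≡ + 0
  AnnihilatesShifts⇒ideal γ ann (gen g) x y = ann g x y
  AnnihilatesShifts⇒ideal γ ann zero x y = refl
  AnnihilatesShifts⇒ideal γ ann (add {p} {q} i j) x y =
    trans (⟨⟩-++ p q _) (cong₂ ℤ._+_ (AnnihilatesShifts⇒ideal γ ann i x y) (AnnihilatesShifts⇒ideal γ ann j x y))
  AnnihilatesShifts⇒ideal γ ann (lmul {p} r i) x y =
    trans (⟨⟩-*P r p _) (⟨⟩-zeroʳ r (λ v →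
      trans (⟨⟩-cong p (λ w → cong γ (reassociate v w))) (AnnihilatesShifts⇒ideal γ ann i (x ++ v) y)))
    where
    reassociate : ∀ v w → x ++ (v ++ w) ++ y ≡ (x ++ v) ++ w ++ y
    reassociate v w = trans (cong (x ++_) (Listₚ.++-assoc v w y)) (sym (Listₚ.++-assoc x v (w ++ y)))
  AnnihilatesShifts⇒ideal γ ann (rmul {p} r i) x y =
    trans (⟨⟩-*P p r _) (trans (⟨⟩-swap p r _) (⟨⟩-zeroʳ r (λ w →
      trans (⟨⟩-cong p (λ v → cong (λ t → γ (x ++ t)) (Listₚ.++-assoc v w y)))
            (AnnihilatesShifts⇒ideal γ ann i x (w ++ y)))))
  AnnihilatesShifts⇒ideal γ ann (resp {p} {q} i p≈q) x y =
    trans (sym (⟨⟩-resp-≈P {p = p} {q} (shift x y γ) p≈q)) (AnnihilatesShifts⇒ideal γ ann i x y)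

  AnnihilatesShifts⇒InPerp : ∀ {G γ} → AnnihilatesShifts G γ → InPerp G γ
  AnnihilatesShifts⇒InPerp {γ = γ} ann z z∈I =
    trans (⟨⟩-cong z (λ t → cong γ (sym (Listₚ.++-identityʳ t))))
          (AnnihilatesShifts⇒ideal γ ann z∈I [] [])

  InPerp⇒AnnihilatesShifts : ∀ {G γ} → InPerp G γ → AnnihilatesShifts G γ
  InPerp⇒AnnihilatesShifts {γ = γ} perp {g} g∈G x y =
    trans (sym (⟨⟩-context x y g γ)) (perp _ (rmul (u y) (lmul (u x) (gen g∈G))))

  InIdeal-mono : ∀ {G H : Poly N → Set} → (∀ {g} → G g → H g) → ∀ {z} → InIdeal G z → InIdeal H z
  InIdeal-mono G⊆H (gen g) = gen (G⊆H g)
  InIdeal-mono G⊆H zero = zero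
  InIdeal-mono G⊆H (add i j) = add (InIdeal-mono G⊆H i) (InIdeal-mono G⊆H j)
  InIdeal-mono G⊆H (lmul r i) = lmul r (InIdeal-mono G⊆H i)
  InIdeal-mono G⊆H (rmul r i) = rmul r (InIdeal-mono G⊆H i)
  InIdeal-mono G⊆H (resp i e) = resp (InIdeal-mono G⊆H i) e

  InIdeal-u-context : ∀ {G : Poly N → Set} x w y → InIdeal G (u w) → InIdeal G (u (x ++ w ++ y))
  InIdeal-u-context x w y i =
    resp (rmul (u y) (lmul (u x) i)) (λ v → cong (λ t → + 1 ℤ.* δ t v ℤ.+ + 0) (Listₚ.++-assoc x w y))

χ : Bool → ℕ
χ true = 1
χ false = 0

χ-injective : ∀ {a b} → χ a ≡ χ b → a ≡ b
χ-injective {true} {true} _ = refl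
χ-injective {false} {false} _ = refl

twoTerm≡0⇒≡ : ∀ i j → p1 ℤ.* i ℤ.+ (m1 ℤ.* j ℤ.+ + 0) ≡ + 0 → i ≡ j
twoTerm≡0⇒≡ i j e = ℤₚ.i-j≡0⇒i≡j i j
  (trans (solve 2 (λ i j → i :- j := con p1 :* i :+ (con m1 :* j :+ con (+ 0))) refl i j) e)

≡⇒twoTerm≡0 : ∀ i → p1 ℤ.* i ℤ.+ (m1 ℤ.* i ℤ.+ + 0) ≡ + 0
≡⇒twoTerm≡0 i =
  trans (solve 1 (λ i → con p1 :* i :+ (con m1 :* i :+ con (+ 0)) := i :- i) refl i) (ℤₚ.+-inverseʳ i)

fourTerm≡0⇒≡ : ∀ i j k l →
  p1 ℤ.* i ℤ.+ (p1 ℤ.* j ℤ.+ (m1 ℤ.* k ℤ.+ (m1 ℤ.* l ℤ.+ + 0))) ≡ + 0 → i ℤ.+ j ≡ k ℤ.+ l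
fourTerm≡0⇒≡ i j k l e = ℤₚ.i-j≡0⇒i≡j _ _ (trans
  (solve 4 (λ i j k l → (i :+ j) :- (k :+ l) :=
     con p1 :* i :+ (con p1 :* j :+ (con m1 :* k :+ (con m1 :* l :+ con (+ 0))))) refl i j k l) e)

≡⇒fourTerm≡0 : ∀ i j k l → i ℤ.+ j ≡ k ℤ.+ l →
  p1 ℤ.* i ℤ.+ (p1 ℤ.* j ℤ.+ (m1 ℤ.* k ℤ.+ (m1 ℤ.* l ℤ.+ + 0))) ≡ + 0
≡⇒fourTerm≡0 i j k l e = begin
  p1 ℤ.* i ℤ.+ (p1 ℤ.* j ℤ.+ (m1 ℤ.* k ℤ.+ (m1 ℤ.* l ℤ.+ + 0)))
    ≡⟨ solve 4 (λ i j k l → con p1 :* i :+ (con p1 :* j :+ (con m1 :* k :+ (con m1 :* l :+ con (+ 0))))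
                := (i :+ j) :- (k :+ l)) refl i j k l ⟩
  (i ℤ.+ j) ℤ.- (k ℤ.+ l)   ≡⟨ cong (λ s → s ℤ.- (k ℤ.+ l)) e ⟩
  (k ℤ.+ l) ℤ.- (k ℤ.+ l)   ≡⟨ ℤₚ.+-inverseʳ (k ℤ.+ l) ⟩
  + 0                       ∎
  where open ≡-Reasoning

module _ {N : ℕ} where

  sumOf-∉ : ∀ {w} (V : List (Word N)) → w ∉ V → sumOf V w ≡ + 0
  sumOf-∉ [] _ = refl
  sumOf-∉ {w} (v ∷ V) w∉V = cong₂ ℤ._+_ (δ-≢ {v = v} {w = w} (w∉V ∘ here ∘ sym)) (sumOf-∉ V (w∉V ∘ there))

  sumOf-∈ : ∀ {w} (V : List (Word N)) → Unique V → w ∈ V → sumOf V w ≡ + 1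
  sumOf-∈ (v ∷ V) (v∉V ∷ _) (here refl) =
    cong₂ ℤ._+_ (δ-refl v) (sumOf-∉ V (λ v∈V → All.lookup v∉V v∈V refl))
  sumOf-∈ {w} (v ∷ V) (v∉V ∷ uV) (there w∈V) =
    cong₂ ℤ._+_ (δ-≢ {v = v} {w = w} (λ { refl → All.lookup v∉V w∈V refl })) (sumOf-∈ V uV w∈V)

module Indicator {N : ℕ} (W : List (Word N)) where
  open import Data.List.Membership.DecPropositional (_≟W_ {N}) using (_∈?_)

  inW : Word N → Bool
  inW w = isYes (w ∈? W)

  inW⇒∈ : ∀ {w} → inW w ≡ true → w ∈ W
  inW⇒∈ {w} e with w ∈? W
  ... | yes w∈W = w∈W

  ∈⇒inW : ∀ {w} → w ∈ W → inW w ≡ true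
  ∈⇒inW {w} w∈W with w ∈? W
  ... | yes _ = refl
  ... | no w∉W = ⊥-elim (w∉W w∈W)

  sumOf≗χ∘inW : Unique W → sumOf W ≗ (λ w → + χ (inW w))
  sumOf≗χ∘inW uW w with w ∈? W
  ... | yes w∈W = sumOf-∈ W uW w∈W
  ... | no w∉W = sumOf-∉ W w∉W

-- Cells: a triple a < b < c or a pair a < b, together with the four arrangements of its letters that
-- can occur on an edge; every admissible move joins an X-arrangement to a Y-arrangement.

data Role : Set where
  X₁ X₂ Y₁ Y₂ : Role

data Cell (N : ℕ) : Set where
  cell₃ : Fin N → Fin N → Fin N → Cell N
  cell₂ : Fin N → Fin N → Cell N

arrangement : ∀ {N} → Cell N → Role → Triple N
arrangement (cell₃ a b c) X₁ = tr b a c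
arrangement (cell₃ a b c) X₂ = tr c a b
arrangement (cell₃ a b c) Y₁ = tr b c a
arrangement (cell₃ a b c) Y₂ = tr a c b
arrangement (cell₂ a b) X₁ = tr a b a
arrangement (cell₂ a b) X₂ = tr b b a
arrangement (cell₂ a b) Y₁ = tr b a a
arrangement (cell₂ a b) Y₂ = tr b a b

Ordered : ∀ {N} → Cell N → Set
Ordered (cell₃ a b c) = a <F b × b <F c
Ordered (cell₂ a b) = a <F b

-- For a pair, the rotation matching consists of the braid move aba–bab and the idempotent move baa–bba.
data Matching : Set where
  knuthMatching rotationMatching : Matching

partner : Matching → Role → Role
partner knuthMatching X₁ = Y₁
partner knuthMatching Y₁ = X₁
partner knuthMatching X₂ = Y₂
partner knuthMatching Y₂ = X₂
partner rotationMatching X₁ = Y₂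
partner rotationMatching Y₂ = X₁
partner rotationMatching X₂ = Y₁
partner rotationMatching Y₁ = X₂

partner-involutive : ∀ e r → partner e (partner e r) ≡ r
partner-involutive knuthMatching X₁ = refl
partner-involutive knuthMatching X₂ = refl
partner-involutive knuthMatching Y₁ = refl
partner-involutive knuthMatching Y₂ = refl
partner-involutive rotationMatching X₁ = refl
partner-involutive rotationMatching X₂ = refl
partner-involutive rotationMatching Y₁ = refl
partner-involutive rotationMatching Y₂ = refl

data Kind : Set where
  knuth rotation undecided : Kind

data Allows : Kind → Matching → Set where
  knuth-allows : Allows knuth knuthMatching
  rotation-allows : Allows rotation rotationMatching
  undecided-allows : ∀ e → Allows undecided e

tripleKind : TripleType → Kind
tripleKind knuthT = knuth
tripleKind rotationT = rotation
tripleKind undecidedT = undecided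

pairKind : PairType → Kind
pairKind knuthP = knuth
pairKind braidP = rotation
pairKind undecidedP = undecided

allows-knuthT : ∀ {t} → t ≡ knuthT ⊎ t ≡ undecidedT → Allows (tripleKind t) knuthMatching
allows-knuthT (inj₁ refl) = knuth-allows
allows-knuthT (inj₂ refl) = undecided-allows _

allows-rotationT : ∀ {t} → t ≡ rotationT ⊎ t ≡ undecidedT → Allows (tripleKind t) rotationMatching
allows-rotationT (inj₁ refl) = rotation-allows
allows-rotationT (inj₂ refl) = undecided-allows _

allows-knuthT⁻¹ : ∀ {t} → Allows (tripleKind t) knuthMatching → t ≡ knuthT ⊎ t ≡ undecidedT
allows-knuthT⁻¹ {t = knuthT} _ = inj₁ refl
allows-knuthT⁻¹ {t = undecidedT} _ = inj₂ refl

allows-rotationT⁻¹ : ∀ {t} → Allows (tripleKind t) rotationMatching → t ≡ rotationT ⊎ t ≡ undecidedT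
allows-rotationT⁻¹ {t = rotationT} _ = inj₁ refl
allows-rotationT⁻¹ {t = undecidedT} _ = inj₂ refl

allows-knuthP : ∀ {t} → t ≡ knuthP ⊎ t ≡ undecidedP → Allows (pairKind t) knuthMatching
allows-knuthP (inj₁ refl) = knuth-allows
allows-knuthP (inj₂ refl) = undecided-allows _

allows-braidP : ∀ {t} → t ≡ braidP ⊎ t ≡ undecidedP → Allows (pairKind t) rotationMatching
allows-braidP (inj₁ refl) = rotation-allows
allows-braidP (inj₂ refl) = undecided-allows _

allows-knuthP⁻¹ : ∀ {t} → Allows (pairKind t) knuthMatching → t ≡ knuthP ⊎ t ≡ undecidedP
allows-knuthP⁻¹ {t = knuthP} _ = inj₁ refl
allows-knuthP⁻¹ {t = undecidedP} _ = inj₂ refl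

allows-braidP⁻¹ : ∀ {t} → Allows (pairKind t) rotationMatching → t ≡ braidP ⊎ t ≡ undecidedP
allows-braidP⁻¹ {t = braidP} _ = inj₁ refl
allows-braidP⁻¹ {t = undecidedP} _ = inj₂ refl

module _ {N : ℕ} where

  -- A pair {a, b} with b - a > 1 is of Knuth kind: I_S contains both of its Knuth relations.
  kind : SemimatchedData N → Cell N → Kind
  kind D (cell₃ a b c) = tripleKind (triple D a b c)
  kind D (cell₂ a b) with toℕ b ℕ.≟ suc (toℕ a)
  ... | yes _ = pairKind (pair D a)
  ... | no _ = knuth

  module _ (D : SemimatchedData N) {a b : Fin N} where

    kind-adjacent : Succ a b → kind D (cell₂ a b) ≡ pairKind (pair D a)
    kind-adjacent b≡1+a with toℕ b ℕ.≟ suc (toℕ a)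
    ... | yes _ = refl
    ... | no b≢1+a = ⊥-elim (b≢1+a b≡1+a)

    kind-far : suc (toℕ a) ℕ.< toℕ b → kind D (cell₂ a b) ≡ knuth
    kind-far a+1<b with toℕ b ℕ.≟ suc (toℕ a)
    ... | yes b≡1+a = ⊥-elim (ℕₚ.<-irrefl (sym b≡1+a) a+1<b)
    ... | no _ = refl

    allows-adjacent : Succ a b → ∀ {e} → Allows (pairKind (pair D a)) e → Allows (kind D (cell₂ a b)) e
    allows-adjacent s = subst (λ k → Allows k _) (sym (kind-adjacent s))

    allows-far : suc (toℕ a) ℕ.< toℕ b → ∀ {e} → Allows knuth e → Allows (kind D (cell₂ a b)) e
    allows-far f = subst (λ k → Allows k _) (sym (kind-far f))

  adjacent-or-far : {a b : Fin N} → a <F b → Succ a b ⊎ suc (toℕ a) ℕ.< toℕ b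
  adjacent-or-far {a} {b} a<b with ℕₚ.<-cmp (suc (toℕ a)) (toℕ b)
  ... | tri< a+1<b _ _ = inj₂ a+1<b
  ... | tri≈ _ a+1≡b _ = inj₁ (sym a+1≡b)
  ... | tri> _ _ b<a+1 = ⊥-elim (ℕₚ.<-irrefl refl (ℕₚ.<-≤-trans b<a+1 a<b))

  adjacent⇒< : {a b : Fin N} → Succ a b → a <F b
  adjacent⇒< {a} b≡1+a = subst (toℕ a ℕ.<_) (sym b≡1+a) (ℕₚ.n<1+n _)

  far⇒< : {a b : Fin N} → suc (toℕ a) ℕ.< toℕ b → a <F b
  far⇒< = ℕₚ.<-trans (ℕₚ.n<1+n _)

  FitsEither : SemimatchedData N → Triple N → Triple N → Set
  FitsEither D t t′ = Fits D t t′ ⊎ Fits D t′ t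

  record FitsView (D : SemimatchedData N) (t t′ : Triple N) : Set where
    constructor fitsAt
    field
      cell     : Cell N
      role     : Role
      matching : Matching
      ordered  : Ordered cell
      allows   : Allows (kind D cell) matching
      source   : t ≡ arrangement cell role
      target   : t′ ≡ arrangement cell (partner matching role)

  viewFits : ∀ D {t t′} → Fits D t t′ → FitsView D t t′
  viewFits D (t-bac-bca a<b b<c k) = fitsAt _ X₁ knuthMatching (a<b , b<c) (allows-knuthT k) refl refl
  viewFits D (t-acb-cab a<b b<c k) = fitsAt _ Y₂ knuthMatching (a<b , b<c) (allows-knuthT k) refl refl
  viewFits D (t-bac-acb a<b b<c k) = fitsAt _ X₁ rotationMatching (a<b , b<c) (allows-rotationT k) refl refl
  viewFits D (t-bca-cab a<b b<c k) = fitsAt _ Y₁ rotationMatching (a<b , b<c) (allows-rotationT k) refl refl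
  viewFits D (far-aba-baa f) = fitsAt _ X₁ knuthMatching (far⇒< f) (allows-far D f knuth-allows) refl refl
  viewFits D (far-bab-bba f) = fitsAt _ Y₂ knuthMatching (far⇒< f) (allows-far D f knuth-allows) refl refl
  viewFits D (kp-aba-baa s k) =
    fitsAt _ X₁ knuthMatching (adjacent⇒< s) (allows-adjacent D s (allows-knuthP k)) refl refl
  viewFits D (kp-bab-bba s k) =
    fitsAt _ Y₂ knuthMatching (adjacent⇒< s) (allows-adjacent D s (allows-knuthP k)) refl refl
  viewFits D (bp-aba-bab s k) =
    fitsAt _ X₁ rotationMatching (adjacent⇒< s) (allows-adjacent D s (allows-braidP k)) refl refl
  viewFits D (bp-baa-bba s k) =
    fitsAt _ Y₁ rotationMatching (adjacent⇒< s) (allows-adjacent D s (allows-braidP k)) refl refl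

  fits-partner : ∀ D (S : Cell N) e → Ordered S → Allows (kind D S) e →
    ∀ r → FitsEither D (arrangement S r) (arrangement S (partner e r))
  fits-partner D (cell₃ a b c) knuthMatching (a<b , b<c) k X₁ = inj₁ (t-bac-bca a<b b<c (allows-knuthT⁻¹ k))
  fits-partner D (cell₃ a b c) knuthMatching (a<b , b<c) k Y₁ = inj₂ (t-bac-bca a<b b<c (allows-knuthT⁻¹ k))
  fits-partner D (cell₃ a b c) knuthMatching (a<b , b<c) k X₂ = inj₂ (t-acb-cab a<b b<c (allows-knuthT⁻¹ k))
  fits-partner D (cell₃ a b c) knuthMatching (a<b , b<c) k Y₂ = inj₁ (t-acb-cab a<b b<c (allows-knuthT⁻¹ k))
  fits-partner D (cell₃ a b c) rotationMatching (a<b , b<c) k X₁ = inj₁ (t-bac-acb a<b b<c (allows-rotationT⁻¹ k))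
  fits-partner D (cell₃ a b c) rotationMatching (a<b , b<c) k Y₂ = inj₂ (t-bac-acb a<b b<c (allows-rotationT⁻¹ k))
  fits-partner D (cell₃ a b c) rotationMatching (a<b , b<c) k X₂ = inj₂ (t-bca-cab a<b b<c (allows-rotationT⁻¹ k))
  fits-partner D (cell₃ a b c) rotationMatching (a<b , b<c) k Y₁ = inj₁ (t-bca-cab a<b b<c (allows-rotationT⁻¹ k))
  fits-partner D (cell₂ a b) e a<b k r with adjacent-or-far a<b
  ... | inj₂ f = far e (subst (λ k → Allows k e) (kind-far D f) k) r
    where
    far : ∀ e → Allows knuth e → ∀ r → FitsEither D (arrangement (cell₂ a b) r) (arrangement (cell₂ a b) (partner e r))
    far knuthMatching _ X₁ = inj₁ (far-aba-baa f)
    far knuthMatching _ Y₁ = inj₂ (far-aba-baa f)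
    far knuthMatching _ X₂ = inj₂ (far-bab-bba f)
    far knuthMatching _ Y₂ = inj₁ (far-bab-bba f)
  ... | inj₁ s = adjacent e (subst (λ k → Allows k e) (kind-adjacent D s) k) r
    where
    adjacent : ∀ e → Allows (pairKind (pair D a)) e →
      ∀ r → FitsEither D (arrangement (cell₂ a b) r) (arrangement (cell₂ a b) (partner e r))
    adjacent knuthMatching k X₁ = inj₁ (kp-aba-baa s (allows-knuthP⁻¹ k))
    adjacent knuthMatching k Y₁ = inj₂ (kp-aba-baa s (allows-knuthP⁻¹ k))
    adjacent knuthMatching k X₂ = inj₂ (kp-bab-bba s (allows-knuthP⁻¹ k))
    adjacent knuthMatching k Y₂ = inj₁ (kp-bab-bba s (allows-knuthP⁻¹ k))
    adjacent rotationMatching k X₁ = inj₁ (bp-aba-bab s (allows-braidP⁻¹ k))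
    adjacent rotationMatching k Y₂ = inj₂ (bp-aba-bab s (allows-braidP⁻¹ k))
    adjacent rotationMatching k X₂ = inj₂ (bp-baa-bba s (allows-braidP⁻¹ k))
    adjacent rotationMatching k Y₁ = inj₁ (bp-baa-bba s (allows-braidP⁻¹ k))

  fits⇒form : ∀ {D t t′} → Fits D t t′ → Form t t′ ⊎ Form t′ t
  fits⇒form (t-bac-bca a<b b<c _) = inj₁ (f-bac-bca a<b b<c)
  fits⇒form (t-acb-cab a<b b<c _) = inj₁ (f-acb-cab a<b b<c)
  fits⇒form (t-bac-acb a<b b<c _) = inj₁ (f-bac-acb a<b b<c)
  fits⇒form (t-bca-cab a<b b<c _) = inj₁ (f-bca-cab a<b b<c)
  fits⇒form (far-aba-baa f) = inj₁ (f-aba-baa (far⇒< f))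
  fits⇒form (far-bab-bba f) = inj₁ (f-bab-bba (far⇒< f))
  fits⇒form (kp-aba-baa s _) = inj₁ (f-aba-baa (adjacent⇒< s))
  fits⇒form (kp-bab-bba s _) = inj₁ (f-bab-bba (adjacent⇒< s))
  fits⇒form (bp-aba-bab s _) = inj₂ (f-bab-aba s)
  fits⇒form (bp-baa-bba s _) = inj₂ (f-bba-baa s)

  fitsEither⇒form : ∀ {D t t′} → FitsEither D t t′ → Form t t′ ⊎ Form t′ t
  fitsEither⇒form (inj₁ f) = fits⇒form f
  fitsEither⇒form (inj₂ f) = swap (fits⇒form f)

data Order : Set where
  lt eq gt : Order

compareℕ : ℕ → ℕ → Order
compareℕ zero zero = eq
compareℕ zero (suc _) = lt
compareℕ (suc _) zero = gt
compareℕ (suc m) (suc n) = compareℕ m n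

compareℕ-< : ∀ {m n} → m ℕ.< n → compareℕ m n ≡ lt
compareℕ-< {zero} {suc n} _ = refl
compareℕ-< {suc m} {suc n} (ℕ.s≤s m<n) = compareℕ-< m<n

compareℕ-> : ∀ {m n} → n ℕ.< m → compareℕ m n ≡ gt
compareℕ-> {suc m} {zero} _ = refl
compareℕ-> {suc m} {suc n} (ℕ.s≤s n<m) = compareℕ-> n<m

compareℕ-refl : ∀ m → compareℕ m m ≡ eq
compareℕ-refl zero = refl
compareℕ-refl (suc m) = compareℕ-refl m

module _ {N : ℕ} where

  classify : Triple N → Maybe (Cell N × Role)
  classify (x , y , z) = go (compare x y) (compare y z) (compare x z)
    where
    compare : Fin N → Fin N → Order
    compare p q = compareℕ (toℕ p) (toℕ q)
    go : Order → Order → Order → Maybe (Cell N × Role)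
    go gt lt lt = just (cell₃ y x z , X₁)
    go gt lt gt = just (cell₃ y z x , X₂)
    go lt gt gt = just (cell₃ z x y , Y₁)
    go lt gt lt = just (cell₃ x z y , Y₂)
    go lt gt eq = just (cell₂ x y , X₁)
    go eq gt gt = just (cell₂ z x , X₂)
    go gt eq gt = just (cell₂ y x , Y₁)
    go gt lt eq = just (cell₂ y x , Y₂)
    go _ _ _ = nothing

  classify-arrangement : ∀ S → Ordered S → ∀ r → classify (arrangement S r) ≡ just (S , r)
  classify-arrangement (cell₃ a b c) (a<b , b<c) X₁
    rewrite compareℕ-> a<b | compareℕ-< b<c | compareℕ-< (ℕₚ.<-trans a<b b<c) = refl
  classify-arrangement (cell₃ a b c) (a<b , b<c) X₂
    rewrite compareℕ-> (ℕₚ.<-trans a<b b<c) | compareℕ-< a<b | compareℕ-> b<c = refl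
  classify-arrangement (cell₃ a b c) (a<b , b<c) Y₁
    rewrite compareℕ-< b<c | compareℕ-> (ℕₚ.<-trans a<b b<c) | compareℕ-> a<b = refl
  classify-arrangement (cell₃ a b c) (a<b , b<c) Y₂
    rewrite compareℕ-< (ℕₚ.<-trans a<b b<c) | compareℕ-> b<c | compareℕ-< a<b = refl
  classify-arrangement (cell₂ a b) a<b X₁ rewrite compareℕ-< a<b | compareℕ-> a<b | compareℕ-refl (toℕ a) = refl
  classify-arrangement (cell₂ a b) a<b X₂ rewrite compareℕ-refl (toℕ b) | compareℕ-> a<b = refl
  classify-arrangement (cell₂ a b) a<b Y₁ rewrite compareℕ-> a<b | compareℕ-refl (toℕ a) = refl
  classify-arrangement (cell₂ a b) a<b Y₂ rewrite compareℕ-> a<b | compareℕ-< a<b | compareℕ-refl (toℕ b) = refl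

  arrangement-injective : ∀ {S S′ r r′} → Ordered S → Ordered S′ →
    arrangement S r ≡ arrangement S′ r′ → S ≡ S′ × r ≡ r′
  arrangement-injective {S} {S′} {r} {r′} o o′ e
    with trans (sym (classify-arrangement S o r)) (trans (cong classify e) (classify-arrangement S′ o′ r′))
  ... | refl = refl , refl

  OneDescent : Triple N → Set
  OneDescent (x , y , z) = (y <F x × ¬ z <F y) ⊎ (¬ y <F x × z <F y)

  arrangement-oneDescent : ∀ S → Ordered S → ∀ r → OneDescent (arrangement S r)
  arrangement-oneDescent (cell₃ a b c) (a<b , b<c) X₁ = inj₁ (a<b , λ c<a → ℕₚ.<-asym c<a (ℕₚ.<-trans a<b b<c))
  arrangement-oneDescent (cell₃ a b c) (a<b , b<c) X₂ = inj₁ (ℕₚ.<-trans a<b b<c , ℕₚ.<-asym a<b)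
  arrangement-oneDescent (cell₃ a b c) (a<b , b<c) Y₁ = inj₂ (ℕₚ.<-asym b<c , ℕₚ.<-trans a<b b<c)
  arrangement-oneDescent (cell₃ a b c) (a<b , b<c) Y₂ = inj₂ (ℕₚ.<-asym (ℕₚ.<-trans a<b b<c) , b<c)
  arrangement-oneDescent (cell₂ a b) a<b X₁ = inj₂ (ℕₚ.<-asym a<b , a<b)
  arrangement-oneDescent (cell₂ a b) a<b X₂ = inj₂ (ℕₚ.<-irrefl refl , a<b)
  arrangement-oneDescent (cell₂ a b) a<b Y₁ = inj₁ (a<b , ℕₚ.<-irrefl refl)
  arrangement-oneDescent (cell₂ a b) a<b Y₂ = inj₁ (a<b , ℕₚ.<-asym a<b)

  oneDescent⇒arrangement : ∀ t → OneDescent t → Σ (Cell N) λ S → Σ Role λ r → Ordered S × arrangement S r ≡ t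
  oneDescent⇒arrangement (x , y , z) (inj₁ (y<x , z≮y)) with Finₚ.<-cmp y z
  ... | tri> _ _ z<y = ⊥-elim (z≮y z<y)
  ... | tri≈ _ refl _ = cell₂ y x , Y₁ , y<x , refl
  ... | tri< y<z _ _ with Finₚ.<-cmp x z
  ...   | tri< x<z _ _ = cell₃ y x z , X₁ , (y<x , x<z) , refl
  ...   | tri≈ _ refl _ = cell₂ y x , Y₂ , y<x , refl
  ...   | tri> _ _ z<x = cell₃ y z x , X₂ , (y<z , z<x) , refl
  oneDescent⇒arrangement (x , y , z) (inj₂ (y≮x , z<y)) with Finₚ.<-cmp x y
  ... | tri> _ _ y<x = ⊥-elim (y≮x y<x)
  ... | tri≈ _ refl _ = cell₂ z x , X₂ , z<y , refl
  ... | tri< x<y _ _ with Finₚ.<-cmp x z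
  ...   | tri< x<z _ _ = cell₃ x z y , Y₂ , (x<z , z<y) , refl
  ...   | tri≈ _ refl _ = cell₂ x y , X₁ , x<y , refl
  ...   | tri> _ _ z<x = cell₃ z x y , Y₁ , (z<x , x<y) , refl

  fitsEither-partner : ∀ {D S r t′} → Ordered S → FitsEither D (arrangement S r) t′ →
    Σ Matching λ e → Allows (kind D S) e × t′ ≡ arrangement S (partner e r)
  fitsEither-partner o (inj₁ f) with viewFits _ f
  ... | fitsAt S′ r′ e o′ allows src tgt with arrangement-injective o o′ src
  ...   | refl , refl = e , allows , tgt
  fitsEither-partner {S = S} o (inj₂ f) with viewFits _ f
  ... | fitsAt S′ r′ e o′ allows src tgt with arrangement-injective o o′ tgt
  ...   | refl , refl = e , allows , trans src (cong (arrangement S) (sym (partner-involutive e r′)))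

Respects : Matching → (Role → Bool) → Set
Respects knuthMatching m = m X₁ ≡ m Y₁ × m X₂ ≡ m Y₂
Respects rotationMatching m = m X₁ ≡ m Y₂ × m X₂ ≡ m Y₁

module _ {m : Role → Bool} where

  respects⇒partner : ∀ {e} → Respects e m → ∀ r → m (partner e r) ≡ m r
  respects⇒partner {knuthMatching} (p , q) X₁ = sym p
  respects⇒partner {knuthMatching} (p , q) Y₁ = p
  respects⇒partner {knuthMatching} (p , q) X₂ = sym q
  respects⇒partner {knuthMatching} (p , q) Y₂ = q
  respects⇒partner {rotationMatching} (p , q) X₁ = sym p
  respects⇒partner {rotationMatching} (p , q) Y₂ = p
  respects⇒partner {rotationMatching} (p , q) X₂ = sym q
  respects⇒partner {rotationMatching} (p , q) Y₁ = q

  partner⇒respects : ∀ e → (∀ r → m (partner e r) ≡ m r) → Respects e m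
  partner⇒respects knuthMatching h = sym (h X₁) , sym (h X₂)
  partner⇒respects rotationMatching h = sym (h X₁) , sym (h X₂)

  -- Membership closed under an involution is invariant under it.
  closed⇒respects : ∀ e → (∀ r → m r ≡ true → m (partner e r) ≡ true) → Respects e m
  closed⇒respects e closed = partner⇒respects e λ r → true-iff (closed r) (λ h → subst (λ s → m s ≡ true)
    (partner-involutive e r) (closed (partner e r) h))
    where
    true-iff : ∀ {a b} → (b ≡ true → a ≡ true) → (a ≡ true → b ≡ true) → a ≡ b
    true-iff {true} {true} _ _ = refl
    true-iff {false} {false} _ _ = refl
    true-iff {true} {false} _ a⇒b = sym (a⇒b refl)
    true-iff {false} {true} b⇒a _ = b⇒a refl

Balanced : (Role → Bool) → Set
Balanced m = χ (m X₁) ℕ.+ χ (m X₂) ≡ χ (m Y₁) ℕ.+ χ (m Y₂)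

-- The relations that the generators of I impose on the four arrangements of a cell of the given kind.
record Relations (k : Kind) (m : Role → Bool) : Set where
  field
    knuth-relations    : k ≡ knuth → Respects knuthMatching m
    rotation-relations : k ≡ rotation → Respects rotationMatching m
    balanced           : Balanced m

matchingFor : Kind → Bool → Bool → Matching
matchingFor knuth _ _ = knuthMatching
matchingFor rotation _ _ = rotationMatching
matchingFor undecided b b′ with b Bool.≟ b′
... | yes _ = knuthMatching
... | no _ = rotationMatching

matchingFor-allowed : ∀ k b b′ → Allows k (matchingFor k b b′)
matchingFor-allowed knuth _ _ = knuth-allows
matchingFor-allowed rotation _ _ = rotation-allows
matchingFor-allowed undecided b b′ = undecided-allows _

relations⇒respects : ∀ k m → Relations k m → Respects (matchingFor k (m X₁) (m Y₁)) m
relations⇒respects knuth m rel = Relations.knuth-relations rel refl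
relations⇒respects rotation m rel = Relations.rotation-relations rel refl
relations⇒respects undecided m rel with m X₁ Bool.≟ m Y₁
... | yes X₁≡Y₁ = X₁≡Y₁ , χ-injective (ℕₚ.+-cancelˡ-≡ (χ (m Y₁)) _ _
                      (subst (λ b → χ b ℕ.+ χ (m X₂) ≡ χ (m Y₁) ℕ.+ χ (m Y₂)) X₁≡Y₁ (Relations.balanced rel)))
... | no X₁≢Y₁ = crossed (m X₁) (m X₂) (m Y₁) (m Y₂) X₁≢Y₁ (Relations.balanced rel)
  where
  crossed : ∀ a b c d → a ≢ c → χ a ℕ.+ χ b ≡ χ c ℕ.+ χ d → a ≡ d × b ≡ c
  crossed true true true _ a≢c _ = ⊥-elim (a≢c refl)
  crossed true false true _ a≢c _ = ⊥-elim (a≢c refl)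
  crossed false _ false _ a≢c _ = ⊥-elim (a≢c refl)
  crossed true false false true _ _ = refl , refl
  crossed false true true false _ _ = refl , refl
  crossed true true false true _ ()
  crossed true true false false _ ()
  crossed true false false false _ ()
  crossed false true true true _ ()
  crossed false false true true _ ()
  crossed false false true false _ ()

-- An edge system on the four arrangements of a cell of kind k, as an I-switchboard induces it.
record LocalMatching (k : Kind) (m : Role → Bool) : Set₁ where
  field
    Edge    : Role → Role → Set
    matched : ∀ r → m r ≡ true → Σ Matching λ e → Allows k e × Edge r (partner e r)
    target  : ∀ {r r′} → Edge r r′ → m r′ ≡ true
    flip    : ∀ {r r′} → Edge r r′ → Edge r′ r
    unique  : ∀ {r r₁ r₂} → Edge r r₁ → Edge r r₂ → r₁ ≡ r₂

PartnersAmong : Role → Role → Role → Set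
PartnersAmong r s s′ = ∀ e → partner e r ≡ s ⊎ partner e r ≡ s′

PartnersAmong-swap : ∀ {r s s′} → PartnersAmong r s s′ → PartnersAmong r s′ s
PartnersAmong-swap p = swap ∘ p

partner-cases : ∀ r → PartnersAmong r (partner knuthMatching r) (partner rotationMatching r)
partner-cases r knuthMatching = inj₁ refl
partner-cases r rotationMatching = inj₂ refl

module _ {k : Kind} {m : Role → Bool} (L : LocalMatching k m) where
  open LocalMatching L

  private
    true≢false : true ≢ false
    true≢false ()

  edge-to-other : ∀ {r s s′} → m r ≡ true → m s ≡ false → PartnersAmong r s s′ → Edge r s′
  edge-to-other {r} r∈ s∉ ps with matched r r∈
  ... | e , _ , edge with ps e
  ...   | inj₁ refl = ⊥-elim (true≢false (trans (sym (target edge)) s∉))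
  ...   | inj₂ refl = edge

  isolated : ∀ {r s s′} → m r ≡ true → m s ≡ false → m s′ ≡ false → PartnersAmong r s s′ → ⊥
  isolated r∈ s∉ s′∉ ps = true≢false (trans (sym (target (edge-to-other r∈ s∉ ps))) s′∉)

  shared : ∀ {r₁ r₂ s s′} → m r₁ ≡ true → m r₂ ≡ true → m s ≡ false →
    PartnersAmong r₁ s s′ → PartnersAmong r₂ s s′ → r₁ ≡ r₂
  shared r₁∈ r₂∈ s∉ ps₁ ps₂ = unique (flip (edge-to-other r₁∈ s∉ ps₁)) (flip (edge-to-other r₂∈ s∉ ps₂))

  forced : ∀ e → (∀ e′ → Allows k e′ → e′ ≡ e) → ∀ r → m r ≡ true → m (partner e r) ≡ true
  forced e only-e r r∈ with matched r r∈
  ... | e′ , allowed , edge rewrite only-e e′ allowed = target edge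

  -- Edges join X- to Y-arrangements and are unique at each vertex, so they pair the occupied X-arrangements
  -- bijectively with the occupied Y-arrangements: unbalanced patterns leave an occupied role with no partner
  -- (isolated) or force two occupied roles to share their only occupied partner (shared).
  localMatching-balanced : Balanced m
  localMatching-balanced with m X₁ in x₁ | m X₂ in x₂ | m Y₁ in y₁ | m Y₂ in y₂
  ... | true  | true  | true  | true  = refl
  ... | true  | false | true  | false = refl
  ... | true  | false | false | true  = refl
  ... | false | true  | true  | false = refl
  ... | false | true  | false | true  = refl
  ... | false | false | false | false = refl
  ... | true  | _     | false | false = ⊥-elim (isolated x₁ y₁ y₂ (partner-cases X₁))
  ... | false | true  | false | false = ⊥-elim (isolated x₂ y₁ y₂ (PartnersAmong-swap (partner-cases X₂)))
  ... | false | false | true  | _     = ⊥-elim (isolated y₁ x₁ x₂ (partner-cases Y₁))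
  ... | false | false | false | true  = ⊥-elim (isolated y₂ x₁ x₂ (PartnersAmong-swap (partner-cases Y₂)))
  ... | true  | true  | true  | false = case shared x₁ x₂ y₂ (PartnersAmong-swap (partner-cases X₁)) (partner-cases X₂) of λ ()
  ... | true  | true  | false | true  = case shared x₁ x₂ y₁ (partner-cases X₁) (PartnersAmong-swap (partner-cases X₂)) of λ ()
  ... | true  | false | true  | true  = case shared y₁ y₂ x₂ (PartnersAmong-swap (partner-cases Y₁)) (partner-cases Y₂) of λ ()
  ... | false | true  | true  | true  = case shared y₁ y₂ x₁ (partner-cases Y₁) (PartnersAmong-swap (partner-cases Y₂)) of λ ()

  localMatching⇒relations : Relations k m
  localMatching⇒relations = record
    { knuth-relations = λ { refl → closed⇒respects knuthMatching (forced knuthMatching only-knuth) }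
    ; rotation-relations = λ { refl → closed⇒respects rotationMatching (forced rotationMatching only-rotation) }
    ; balanced = localMatching-balanced
    }
    where
    only-knuth : ∀ e → Allows knuth e → e ≡ knuthMatching
    only-knuth _ knuth-allows = refl
    only-rotation : ∀ e → Allows rotation e → e ≡ rotationMatching
    only-rotation _ rotation-allows = refl

respects⇒balanced : ∀ {m} e → Respects e m → Balanced m
respects⇒balanced knuthMatching (p , q) = cong₂ (λ a b → χ a ℕ.+ χ b) p q
respects⇒balanced {m} rotationMatching (p , q) =
  trans (cong₂ (λ a b → χ a ℕ.+ χ b) p q) (ℕₚ.+-comm (χ (m Y₂)) (χ (m Y₁)))

module _ {N : ℕ} where

  plug : Word N → Triple N → Word N → Word N
  plug x (p , q , r) y = x ++ p ∷ q ∷ r ∷ y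

  !-++ : ∀ (x l : Word N) j → (x ++ l) ! (j ℕ.+ length x) ≡ l ! j
  !-++ [] l j rewrite ℕₚ.+-identityʳ j = refl
  !-++ (a ∷ x) l j rewrite ℕₚ.+-suc j (length x) = !-++ x l j

  module _ (x y : Word N) (p q r : Fin N) where
    private
      w = plug x (p , q , r) y

    descent₁⇒ : Descent w (suc (length x)) → q <F p
    descent₁⇒ (_ , _ , e₁ , e₂ , below)
      with just-injective (trans (sym (!-++ x _ 0)) e₁) | just-injective (trans (sym (!-++ x _ 1)) e₂)
    ... | refl | refl = below

    descent₁⇐ : q <F p → Descent w (suc (length x))
    descent₁⇐ q<p = p , q , !-++ x _ 0 , !-++ x _ 1 , q<p

    descent₂⇒ : Descent w (suc (suc (length x))) → r <F q
    descent₂⇒ (_ , _ , e₁ , e₂ , below)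
      with just-injective (trans (sym (!-++ x _ 1)) e₁) | just-injective (trans (sym (!-++ x _ 2)) e₂)
    ... | refl | refl = below

    descent₂⇐ : r <F q → Descent w (suc (suc (length x)))
    descent₂⇐ r<q = q , r , !-++ x _ 1 , !-++ x _ 2 , r<q

    oneDescent⇒exactlyOneDescent : OneDescent (p , q , r) → ExactlyOneDescent w (suc (suc (length x)))
    oneDescent⇒exactlyOneDescent (inj₁ (q<p , r≮q)) = inj₁ (descent₁⇐ q<p , r≮q ∘ descent₂⇒)
    oneDescent⇒exactlyOneDescent (inj₂ (q≮p , r<q)) = inj₂ (q≮p ∘ descent₁⇒ , descent₂⇐ r<q)

    exactlyOneDescent⇒oneDescent : ExactlyOneDescent w (suc (suc (length x))) → OneDescent (p , q , r)
    exactlyOneDescent⇒oneDescent (inj₁ (d₁ , ¬d₂)) = inj₁ (descent₁⇒ d₁ , ¬d₂ ∘ descent₂⇐)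
    exactlyOneDescent⇒oneDescent (inj₂ (¬d₁ , d₂)) = inj₂ (¬d₁ ∘ descent₁⇐ , descent₂⇒ d₂)

  plug-length : ∀ x t y → 3 ℕ.+ length x ℕ.≤ length (plug x t y)
  plug-length [] t y = ℕ.s≤s (ℕ.s≤s (ℕ.s≤s ℕ.z≤n))
  plug-length (a ∷ x) t y = ℕ.s≤s (plug-length x t y)

  decompose : ∀ k (w : Word N) → 3 ℕ.+ k ℕ.≤ length w →
    Σ (Word N) λ x → Σ (Triple N) λ t → Σ (Word N) λ y → length x ≡ k × w ≡ plug x t y
  decompose zero (p ∷ q ∷ r ∷ y) _ = [] , (p , q , r) , y , refl , refl
  decompose zero (_ ∷ []) (ℕ.s≤s ())
  decompose zero (_ ∷ _ ∷ []) (ℕ.s≤s (ℕ.s≤s ()))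
  decompose (suc k) (a ∷ w) (ℕ.s≤s 3+k≤w) with decompose k w (subst (ℕ._≤ length w) (ℕₚ.+-suc 2 k) 3+k≤w)
  ... | x , t , y , refl , refl = a ∷ x , t , y , refl , refl

  ++-cancel-length : ∀ (x x′ : Word N) {y y′} → length x ≡ length x′ → x ++ y ≡ x′ ++ y′ → x ≡ x′ × y ≡ y′
  ++-cancel-length [] [] _ e = refl , e
  ++-cancel-length (a ∷ x) (a′ ∷ x′) l e with Listₚ.∷-injective e
  ... | refl , e′ with ++-cancel-length x x′ (ℕₚ.suc-injective l) e′
  ...   | refl , refl = refl , refl

  plug-injective : ∀ {x x′ y y′ : Word N} {t t′} → length x ≡ length x′ →
    plug x t y ≡ plug x′ t′ y′ → x ≡ x′ × t ≡ t′ × y ≡ y′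
  plug-injective {x} {x′} {t = _ , _ , _} {_ , _ , _} l e with ++-cancel-length x x′ l e
  ... | refl , refl = refl , refl , refl

≤∸1⇒< : ∀ {k L} → 2 ℕ.+ k ℕ.≤ L ℕ.∸ 1 → 3 ℕ.+ k ℕ.≤ L
≤∸1⇒< {L = suc L} 2+k≤L = ℕ.s≤s 2+k≤L

module Switchboards {N : ℕ} (D : SemimatchedData N) (n : ℕ) (W : List (Word N))
                    (uniqueW : Unique W) (lengthW : All (λ w → length w ≡ n) W) where
  open Indicator W

  occupancy : Word N → Word N → Cell N → Role → Bool
  occupancy x y S r = inW (plug x (arrangement S r) y)

  CellRelations : Set
  CellRelations = ∀ x y S → Ordered S → Relations (kind D S) (occupancy x y S)

  AvoidsIM : Set
  AvoidsIM = ∀ {w} → w ∈ W → ¬ InIdeal (MonoGen D) (u w)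

  χ-shift : Word N → Word N → Dual N
  χ-shift x y t = + χ (inW (x ++ t ++ y))

  shift-sumOf≗χ-shift : ∀ x y → shift x y (sumOf W) ≗ χ-shift x y
  shift-sumOf≗χ-shift x y t = sumOf≗χ∘inW uniqueW (x ++ t ++ y)

  twoTerm⇒≡ : ∀ {a b} → p1 ℤ.* + χ a ℤ.+ (m1 ℤ.* + χ b ℤ.+ + 0) ≡ + 0 → a ≡ b
  twoTerm⇒≡ {a} {b} e = χ-injective (ℤₚ.+-injective (twoTerm≡0⇒≡ (+ χ a) (+ χ b) e))

  ≡⇒twoTerm : ∀ {a b} → a ≡ b → p1 ℤ.* + χ a ℤ.+ (m1 ℤ.* + χ b ℤ.+ + 0) ≡ + 0
  ≡⇒twoTerm {a} refl = ≡⇒twoTerm≡0 (+ χ a)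

  fourTerm⇒+≡ : ∀ {a b c d} → p1 ℤ.* + χ a ℤ.+ (p1 ℤ.* + χ b ℤ.+ (m1 ℤ.* + χ c ℤ.+ (m1 ℤ.* + χ d ℤ.+ + 0))) ≡ + 0 →
    χ a ℕ.+ χ b ≡ χ c ℕ.+ χ d
  fourTerm⇒+≡ {a} {b} {c} {d} e = ℤₚ.+-injective (fourTerm≡0⇒≡ (+ χ a) (+ χ b) (+ χ c) (+ χ d) e)

  +≡⇒fourTerm : ∀ {a b c d} → χ a ℕ.+ χ b ≡ χ c ℕ.+ χ d →
    p1 ℤ.* + χ a ℤ.+ (p1 ℤ.* + χ b ℤ.+ (m1 ℤ.* + χ c ℤ.+ (m1 ℤ.* + χ d ℤ.+ + 0))) ≡ + 0
  +≡⇒fourTerm {a} {b} {c} {d} e = ≡⇒fourTerm≡0 (+ χ a) (+ χ b) (+ χ c) (+ χ d) (cong +_ e)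

  plug∈W⇒label : ∀ x t y → plug x t y ∈ W → 2 ℕ.+ length x ℕ.≤ n ℕ.∸ 1
  plug∈W⇒label x t y w∈W =
    subst (λ L → 2 ℕ.+ length x ℕ.≤ L ℕ.∸ 1) (All.lookup lengthW w∈W) (ℕₚ.∸-monoˡ-≤ 1 (plug-length x t y))

  InPerp⇒AvoidsIM : InPerp (SGen D) (sumOf W) → AvoidsIM
  InPerp⇒AvoidsIM perp {w} w∈W w∈IM with trans (sym (perp (u w) (InIdeal-mono (λ { (mono g) → mono g }) w∈IM)))
                                              (cong (λ k → p1 ℤ.* k ℤ.+ + 0) (sumOf-∈ W uniqueW w∈W))
  ... | ()

  module _ (perp : InPerp (SGen D) (sumOf W)) (x y : Word N) where

    private
      vanishes : ∀ {g} → SGen D g → ⟨ g , χ-shift x y ⟩ ≡ + 0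
      vanishes {g} g∈G = trans (sym (⟨⟩-cong g (shift-sumOf≗χ-shift x y))) (InPerp⇒AnnihilatesShifts perp g∈G x y)

    balanced₃ : ∀ {a b c} → a <F b → b <F c → Balanced (occupancy x y (cell₃ a b c))
    balanced₃ {a} {b} {c} a<b b<c = let m = occupancy x y (cell₃ a b c) in
      sym (fourTerm⇒+≡ {m Y₁} {m Y₂} {m X₁} {m X₂} (vanishes (s-tri a<b b<c)))

    InPerp⇒relations₃ : ∀ {a b c} → a <F b → b <F c →
      Relations (kind D (cell₃ a b c)) (occupancy x y (cell₃ a b c))
    InPerp⇒relations₃ {a} {b} {c} a<b b<c with triple D a b c in type≡
    ... | knuthT = record
      { knuth-relations = λ _ → twoTerm⇒≡ (vanishes (kt2 a<b b<c type≡)) , sym (twoTerm⇒≡ (vanishes (kt1 a<b b<c type≡)))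
      ; rotation-relations = λ ()
      ; balanced = balanced₃ a<b b<c }
    ... | rotationT = record
      { knuth-relations = λ ()
      ; rotation-relations = λ _ → sym (twoTerm⇒≡ (vanishes (rt1 a<b b<c type≡))) , twoTerm⇒≡ (vanishes (rt2 a<b b<c type≡))
      ; balanced = balanced₃ a<b b<c }
    ... | undecidedT = record
      { knuth-relations = λ ()
      ; rotation-relations = λ ()
      ; balanced = balanced₃ a<b b<c }

    balanced₂ : ∀ {a b} → Succ a b → Balanced (occupancy x y (cell₂ a b))
    balanced₂ {a} {b} s = let m = occupancy x y (cell₂ a b) in
      trans (ℕₚ.+-comm (χ (m X₁)) (χ (m X₂)))
            (trans (fourTerm⇒+≡ {m X₂} {m X₁} {m Y₂} {m Y₁} (vanishes (s-adj s))) (ℕₚ.+-comm (χ (m Y₂)) (χ (m Y₁))))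

    InPerp⇒relations₂-adjacent : ∀ {a b} → Succ a b →
      Relations (pairKind (pair D a)) (occupancy x y (cell₂ a b))
    InPerp⇒relations₂-adjacent {a} {b} s with pair D a in type≡
    ... | knuthP = record
      { knuth-relations = λ _ → twoTerm⇒≡ (vanishes (kp1 s type≡)) , sym (twoTerm⇒≡ (vanishes (kp2 s type≡)))
      ; rotation-relations = λ ()
      ; balanced = balanced₂ s }
    ... | braidP = record
      { knuth-relations = λ ()
      ; rotation-relations = λ _ → twoTerm⇒≡ (vanishes (bp1 s type≡)) , sym (twoTerm⇒≡ (vanishes (bp2 s type≡)))
      ; balanced = balanced₂ s }
    ... | undecidedP = record
      { knuth-relations = λ ()
      ; rotation-relations = λ ()
      ; balanced = balanced₂ s }

    InPerp⇒relations₂-far : ∀ {a b} → suc (toℕ a) ℕ.< toℕ b → Relations knuth (occupancy x y (cell₂ a b))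
    InPerp⇒relations₂-far {a} {b} f = record
      { knuth-relations = λ _ → respects
      ; rotation-relations = λ ()
      ; balanced = respects⇒balanced {occupancy x y (cell₂ a b)} knuthMatching respects }
      where
      respects : Respects knuthMatching (occupancy x y (cell₂ a b))
      respects = sym (twoTerm⇒≡ (vanishes (s-far2 f))) , twoTerm⇒≡ (vanishes (s-far1 f))

  InPerp⇒CellRelations : InPerp (SGen D) (sumOf W) → CellRelations
  InPerp⇒CellRelations perp x y (cell₃ a b c) (a<b , b<c) = InPerp⇒relations₃ perp x y a<b b<c
  InPerp⇒CellRelations perp x y (cell₂ a b) a<b with adjacent-or-far a<b
  ... | inj₁ s = subst (λ k → Relations k _) (sym (kind-adjacent D s)) (InPerp⇒relations₂-adjacent perp x y s)
  ... | inj₂ f = subst (λ k → Relations k _) (sym (kind-far D f)) (InPerp⇒relations₂-far perp x y f)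

  module _ (avoids : AvoidsIM) (cells : CellRelations) (x y : Word N) where
    open Relations

    private
      triple-relations : ∀ {a b c} → a <F b → b <F c →
        Relations (tripleKind (triple D a b c)) (occupancy x y (cell₃ a b c))
      triple-relations a<b b<c = cells x y (cell₃ _ _ _) (a<b , b<c)

      adjacent-relations : ∀ {a b} → Succ a b → Relations (pairKind (pair D a)) (occupancy x y (cell₂ a b))
      adjacent-relations s = subst (λ k → Relations k _) (kind-adjacent D s) (cells x y (cell₂ _ _) (adjacent⇒< s))

      far-relations : ∀ {a b} → suc (toℕ a) ℕ.< toℕ b → Relations knuth (occupancy x y (cell₂ a b))
      far-relations f = subst (λ k → Relations k _) (kind-far D f) (cells x y (cell₂ _ _) (far⇒< f))

    generator-vanishes : ∀ {g} → SGen D g → ⟨ g , χ-shift x y ⟩ ≡ + 0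
    generator-vanishes (mono {w} w∈IM) with inW (x ++ w ++ y) in occupied
    ... | true = ⊥-elim (avoids (inW⇒∈ occupied) (InIdeal-u-context x w y (gen (mono w∈IM))))
    ... | false = refl
    generator-vanishes (s-adj {a} {b} s) = let m = occupancy x y (cell₂ a b) in
      +≡⇒fourTerm {m X₂} {m X₁} {m Y₂} {m Y₁} (trans (ℕₚ.+-comm (χ (m X₂)) (χ (m X₁)))
        (trans (balanced (adjacent-relations s)) (ℕₚ.+-comm (χ (m Y₁)) (χ (m Y₂)))))
    generator-vanishes (s-far1 f) = ≡⇒twoTerm (proj₂ (knuth-relations (far-relations f) refl))
    generator-vanishes (s-far2 f) = ≡⇒twoTerm (sym (proj₁ (knuth-relations (far-relations f) refl)))
    generator-vanishes (s-tri {a} {b} {c} a<b b<c) = let m = occupancy x y (cell₃ a b c) in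
      +≡⇒fourTerm {m Y₁} {m Y₂} {m X₁} {m X₂} (sym (balanced (triple-relations a<b b<c)))
    generator-vanishes (kt1 a<b b<c k) = ≡⇒twoTerm (sym (proj₂ (knuth-relations (triple-relations a<b b<c) (cong tripleKind k))))
    generator-vanishes (kt2 a<b b<c k) = ≡⇒twoTerm (proj₁ (knuth-relations (triple-relations a<b b<c) (cong tripleKind k)))
    generator-vanishes (rt1 a<b b<c k) = ≡⇒twoTerm (sym (proj₁ (rotation-relations (triple-relations a<b b<c) (cong tripleKind k))))
    generator-vanishes (rt2 a<b b<c k) = ≡⇒twoTerm (proj₂ (rotation-relations (triple-relations a<b b<c) (cong tripleKind k)))
    generator-vanishes (kp1 s k) = ≡⇒twoTerm (proj₁ (knuth-relations (adjacent-relations s) (cong pairKind k)))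
    generator-vanishes (kp2 s k) = ≡⇒twoTerm (sym (proj₂ (knuth-relations (adjacent-relations s) (cong pairKind k))))
    generator-vanishes (bp1 s k) = ≡⇒twoTerm (proj₁ (rotation-relations (adjacent-relations s) (cong pairKind k)))
    generator-vanishes (bp2 s k) = ≡⇒twoTerm (sym (proj₂ (rotation-relations (adjacent-relations s) (cong pairKind k))))

  CellRelations⇒InPerp : AvoidsIM → CellRelations → InPerp (SGen D) (sumOf W)
  CellRelations⇒InPerp avoids cells = AnnihilatesShifts⇒InPerp λ {g} g∈G x y →
    trans (⟨⟩-cong g (shift-sumOf≗χ-shift x y)) (generator-vanishes avoids cells x y g∈G)

  module _ (cells : CellRelations) where

    chosen : Word N → Word N → Cell N → Matching
    chosen x y S = matchingFor (kind D S) (occupancy x y S X₁) (occupancy x y S Y₁)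

    partner-occupancy : ∀ {x y S} → Ordered S → ∀ r → occupancy x y S (partner (chosen x y S) r) ≡ occupancy x y S r
    partner-occupancy {x} {y} {S} o = respects⇒partner (relations⇒respects (kind D S) _ (cells x y S o))

    record Edge (i : ℕ) (w w′ : Word N) : Set where
      constructor edge
      field
        prefix suffix : Word N
        cell          : Cell N
        role          : Role
        ordered       : Ordered cell
        label         : i ≡ 2 ℕ.+ length prefix
        source        : w ≡ plug prefix (arrangement cell role) suffix
        target        : w′ ≡ plug prefix (arrangement cell (partner (chosen prefix suffix cell) role)) suffix
        occupied      : occupancy prefix suffix cell role ≡ true

    Edge-sym : ∀ {i w w′} → Edge i w w′ → Edge i w′ w
    Edge-sym (edge x y S r o l s t occ) =
      edge x y S (partner (chosen x y S) r) o l t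
           (trans s (cong (λ r → plug x (arrangement S r) y) (sym (partner-involutive (chosen x y S) r))))
           (trans (partner-occupancy o r) occ)

    Edge-ends : ∀ {i w w′} → Edge i w w′ → w ∈ W × w′ ∈ W
    Edge-ends (edge x y S r o _ refl refl occ) = inW⇒∈ occ , inW⇒∈ (trans (partner-occupancy o r) occ)

    Edge-label : ∀ {i w w′} → Edge i w w′ → 2 ℕ.≤ i × i ℕ.≤ n ℕ.∸ 1
    Edge-label (edge x y _ _ _ refl refl refl occ) = ℕ.s≤s (ℕ.s≤s ℕ.z≤n) , plug∈W⇒label x _ y (inW⇒∈ occ)

    Edge-fits : ∀ {i w w′} → Edge i w w′ →
      Σ (Triple N) λ t → Σ (Triple N) λ t′ → LocalAt i w w′ t t′ × FitsEither D t t′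
    Edge-fits (edge x y S r o refl refl refl _) =
      _ , _ , (x , y , refl , refl , refl) ,
      fits-partner D S _ o (matchingFor-allowed (kind D S) _ _) r

    Edge-shape : ∀ {i w w′} → Edge i w w′ →
      Σ (Triple N) λ t → Σ (Triple N) λ t′ → LocalAt i w w′ t t′ × (Form t t′ ⊎ Form t′ t)
    Edge-shape e with Edge-fits e
    ... | t , t′ , local , fits = t , t′ , local , fitsEither⇒form fits

    Edge-unique : ∀ {i w} → w ∈ W → 2 ℕ.≤ i → i ℕ.≤ n ℕ.∸ 1 → ExactlyOneDescent w i →
      Σ (Word N) λ w′ → Edge i w w′ × (∀ w″ → Edge i w w″ → w″ ≡ w′)
    Edge-unique {suc (suc k)} {w} w∈W (ℕ.s≤s (ℕ.s≤s _)) i≤n∸1 exactlyOne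
      with decompose k w (≤∸1⇒< (subst (λ L → 2 ℕ.+ k ℕ.≤ L ℕ.∸ 1) (sym (All.lookup lengthW w∈W)) i≤n∸1))
    ... | x , (p , q , r) , y , refl , refl
      with oneDescent⇒arrangement (p , q , r) (exactlyOneDescent⇒oneDescent x y p q r exactlyOne)
    ...   | S , ρ , o , refl = _ , edge x y S ρ o refl refl refl (∈⇒inW w∈W) , only
      where
      only : ∀ w″ → Edge _ (plug x (arrangement S ρ) y) w″ → w″ ≡ plug x (arrangement S (partner (chosen x y S) ρ)) y
      only _ (edge x′ y′ S′ ρ′ o′ l s refl _)
        with plug-injective {x = x} {x′} (ℕₚ.suc-injective (ℕₚ.suc-injective l)) s
      ... | refl , same , refl with arrangement-injective o o′ same
      ...   | refl , refl = refl

    CellRelations⇒ISwitchboard : AvoidsIM → IsISwitchboard D n W Edge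
    CellRelations⇒ISwitchboard avoids = record
      { switchboard = record
        { sym = Edge-sym ; ends = Edge-ends ; label = Edge-label ; shape = Edge-shape ; unique = Edge-unique }
      ; notInIM = avoids
      ; fits = Edge-fits
      }

  module _ {E : ℕ → Word N → Word N → Set} (sb : IsISwitchboard D n W E) where
    open IsISwitchboard sb using (switchboard; fits)
    open IsSwitchboard switchboard using (ends; unique) renaming (sym to edge-sym)

    switchboard-localMatching : ∀ x y S → Ordered S → LocalMatching (kind D S) (occupancy x y S)
    switchboard-localMatching x y S o = record
      { Edge = λ r r′ → E i (w r) (w r′)
      ; matched = matched
      ; target = λ e → ∈⇒inW (proj₂ (ends e))
      ; flip = edge-sym
      ; unique = only-one
      }
      where
      i = 2 ℕ.+ length x
      w : Role → Word N
      w r = plug x (arrangement S r) y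

      edge-at : ∀ r → w r ∈ W → Σ (Word N) λ w′ → E i (w r) w′ × (∀ w″ → E i (w r) w″ → w″ ≡ w′)
      edge-at r w∈W = unique w∈W (ℕ.s≤s (ℕ.s≤s ℕ.z≤n)) (plug∈W⇒label x _ y w∈W)
        (oneDescent⇒exactlyOneDescent x y _ _ _ (arrangement-oneDescent S o r))

      matched : ∀ r → occupancy x y S r ≡ true → Σ Matching λ e → Allows (kind D S) e × E i (w r) (w (partner e r))
      matched r occ with edge-at r (inW⇒∈ occ)
      ... | _ , e , _ with fits e
      ...   | _ , _ , (x′ , _ , l , s , refl) , fitting with plug-injective {x = x} {x′} (sym l) s
      ...     | refl , refl , refl with fitsEither-partner o fitting
      ...       | m , allows , refl = m , allows , e

      only-one : ∀ {r r₁ r₂} → E i (w r) (w r₁) → E i (w r) (w r₂) → r₁ ≡ r₂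
      only-one {r} e₁ e₂ with edge-at r (proj₁ (ends e₁))
      ... | _ , _ , only with plug-injective {x = x} {x} refl (trans (only _ e₁) (sym (only _ e₂)))
      ...   | _ , same , _ = proj₂ (arrangement-injective o o same)

    ISwitchboard⇒CellRelations : CellRelations
    ISwitchboard⇒CellRelations x y S o = localMatching⇒relations (switchboard-localMatching x y S o)

proposition6p2 : ∀ (N : ℕ) (D : SemimatchedData N) (n : ℕ) (W : List (Word N)) →
    Unique W → All (λ w → length w ≡ n) W →
    (InPerp (SGen D) (sumOf W) → Σ (ℕ → Word N → Word N → Set) (IsISwitchboard D n W))
    × (Σ (ℕ → Word N → Word N → Set) (IsISwitchboard D n W) → InPerp (SGen D) (sumOf W))
proposition6p2 N D n W uniqueW lengthW = perp⇒switchboard , switchboard⇒perp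
  where
  open Switchboards D n W uniqueW lengthW

  perp⇒switchboard : InPerp (SGen D) (sumOf W) → Σ (ℕ → Word N → Word N → Set) (IsISwitchboard D n W)
  perp⇒switchboard perp =
    Edge (InPerp⇒CellRelations perp) , CellRelations⇒ISwitchboard (InPerp⇒CellRelations perp) (InPerp⇒AvoidsIM perp)

  switchboard⇒perp : Σ (ℕ → Word N → Word N → Set) (IsISwitchboard D n W) → InPerp (SGen D) (sumOf W)
  switchboard⇒perp (_ , sb) = CellRelations⇒InPerp (IsISwitchboard.notInIM sb) (ISwitchboard⇒CellRelations sb)
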